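{- Let $q\ge 1$ and $d\ge 1$ be integers and let $G$ be any $d$-degenerate graph. In the $q$-color online Ramsey game, Builder has a strategy which, against every strategy of Painter, forces Painter after finitely many moves to have produced a monochromatic copy of $G$, while the graph formed by all edges exposed by Builder is at all times $(qd-(q-1))$-degenerate.
   Context: The $q$-color online Ramsey game is played by two players, Builder and Painter, on an infinite set of vertices which initially spans no edges. In each step Builder exposes a new edge between two vertices, and Painter immediately colors this edge with one of $q$ colors. Builder's aim is to force the existence of a monochromatic copy of a fixed graph $G$ (a copy of $G$ all of whose edges receive the same color). A graph is $k$-degenerate if every subgraph of it has a vertex of degree at most $k$; equivalently, its vertices can be ordered $u_1,\dots,u_N$ so that each $u_i$ has at most $k$ neighbors $u_j$ with $j<i$. -}

module Defs where

open import Data.Nat using (ℕ; _≤_)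
import Data.Nat as ℕ
open import Data.Fin using (Fin)
import Data.Fin as Fin
open import Data.Product using (Σ; _×_; _,_; proj₁; proj₂)
open import Data.Unit using (⊤)
open import Data.Product.Properties using (≡-dec)
open import Data.Sum using (_⊎_)
open import Data.List using (List; []; _∷_; _++_; [_]; length; filter; map)
open import Data.List.Relation.Unary.All using (All)
open import Data.List.Relation.Unary.Unique.Propositional using (Unique)
open import Data.List.Membership.Propositional using (_∈_)
import Data.List.Membership.DecPropositional as DecMem
open import Relation.Nullary using (¬_; Dec)
open import Relation.Nullary.Decidable using (_⊎-dec_)
open import Relation.Binary.PropositionalEquality using (_≡_; _≢_)
open import Relation.Binary.Definitions using (DecidableEquality)
open import Function.Definitions using (Injective)

-- Graphs given by an (undirected) edge list over a vertex type V with
-- decidable equality.  An entry (u , v) of the list stands for the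
-- undirected edge {u , v}.

Adj : {V : Set} → List (V × V) → V → V → Set
Adj E u v = ((u , v) ∈ E) ⊎ ((v , u) ∈ E)

adj? : {V : Set} → DecidableEquality V → (E : List (V × V)) → (u v : V) → Dec (Adj E u v)
adj? _≟_ E u v = (DecMem._∈?_ (≡-dec _≟_ _≟_) (u , v) E) ⊎-dec (DecMem._∈?_ (≡-dec _≟_ _≟_) (v , u) E)

-- OrderOK k E L : L lists vertices in REVERSE order (latest vertex first);
-- each vertex has at most k neighbours among the vertices listed after it
-- (i.e. among the earlier vertices of the ordering).
OrderOK : {V : Set} → DecidableEquality V → ℕ → List (V × V) → List V → Set
OrderOK _≟_ k E [] = ⊤
OrderOK _≟_ k E (v ∷ L) = length (filter (λ u → adj? _≟_ E u v) L) ≤ k × OrderOK _≟_ k E L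

-- A graph (with edge list E) is k-degenerate iff its (non-isolated) vertices
-- admit an ordering u₁,…,u_N (without repetitions) in which every uᵢ has at
-- most k neighbours uⱼ with j < i.  Isolated vertices are irrelevant.
Degenerate : {V : Set} → DecidableEquality V → ℕ → List (V × V) → Set
Degenerate {V} _≟_ k E =
  Σ (List V) λ L → Unique L
    × (∀ {u v} → (u , v) ∈ E → (u ∈ L) × (v ∈ L))
    × OrderOK _≟_ k E L

-- Finite simple graphs (the target graph G): vertex set Fin n, edge list
-- without loops (repeated entries are harmless).

record Graph : Set where
  field
    n      : ℕ
    edges  : List (Fin n × Fin n)
    noLoop : All (λ e → proj₁ e ≢ proj₂ e) edges

open Graph public

DegenerateGraph : ℕ → Graph → Set
DegenerateGraph k G = Degenerate Fin._≟_ k (edges G)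

History : ℕ → Set
History q = List ((ℕ × ℕ) × Fin q)

exposed : {q : ℕ} → History q → List (ℕ × ℕ)
exposed = map proj₁

Builder : ℕ → Set
Builder q = History q → ℕ × ℕ

Painter : ℕ → Set
Painter q = History q → ℕ × ℕ → Fin q

play : {q : ℕ} → Builder q → Painter q → ℕ → History q
play B P ℕ.zero = []
play B P (ℕ.suc t) = h ++ [ (B h , P h (B h)) ]
  where h = play B P t

Legal : {q : ℕ} → History q → ℕ × ℕ → Set
Legal h (u , v) = u ≢ v × ¬ (Adj (exposed h) u v)

MonoCopy : {q : ℕ} → Graph → History q → Set
MonoCopy {q} G h =
  Σ (Fin q) λ c → Σ (Fin (n G) → ℕ) λ f →
    Injective _≡_ _≡_ f ×
    All (λ e → (((f (proj₁ e) , f (proj₂ e)) , c) ∈ h)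
             ⊎ (((f (proj₂ e) , f (proj₁ e)) , c) ∈ h))
        (edges G)

{-# OPTIONS --safe #-}

-- Builder keeps an increasing list R of vertices none of which is the smaller
-- end of an edge.  Write k = q(d − 1) + 1 and split R into W followed by Z₀.
-- Builder gives every k-subset of Z₀ its own vertex of W and joins the two; by
-- pigeonhole d of the k edges share a colour.  Ramsey's theorem for d-subsets
-- then gives a large Z ⊆ Z₀ and a colour c such that every d-subset of Z has a
-- common c-neighbour in W.
-- The target is embedded from its last vertex backwards: for each colour c
-- there is an initial part B of the degeneracy order such that every injection
-- of B into R extends to a c-coloured embedding of all edges not inside B.
-- Restricting to Z keeps this for all colours, and for the colour c above it
-- removes the last vertex of B, whose image is chosen in W.
-- Every edge is recorded as (w , z) with w < z, and each w is the smaller end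
-- of at most k edges, so the order by decreasing number is a degeneracy order.

module Submission where

open import Defs
open import Data.Nat using (ℕ; _≤_; _<_; _*_; _∸_)
open import Data.Product using (Σ; _×_)
open import Data.Nat using (_≟_)

open import Data.Fin using (Fin; zero; suc)
import Data.Fin as Fin
import Data.Fin.Properties as Fin
open import Data.List using (List; []; _∷_; _++_; [_]; length; filter; map; take; drop; upTo; allFin)
open import Data.List.Membership.Propositional using (_∈_; _∉_; lose; find)
open import Data.List.Membership.Propositional.Properties
  using (∈-++⁺ˡ; ∈-++⁺ʳ; ∈-++⁻; ∈-map⁺; ∈-map⁻; ∈-filter⁺; ∈-filter⁻; ∈-upTo⁺; ∈-upTo⁻; ∈-allFin)
import Data.List.Membership.DecPropositional as DecMembership
open import Data.List.Properties
  using (length-++; length-map; length-take; length-drop; length-upTo; take++drop≡id;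
         filter-notAll; filter-none; map-++; ++-assoc; ++-identityʳ)
open import Data.List.Relation.Binary.Sublist.Propositional
  using (_⊆_; []; _∷_; _∷ʳ_; ⊆-refl; ⊆-trans; minimum; lookup)
open import Data.List.Relation.Binary.Sublist.Propositional.Properties
  using (take-⊆; drop-⊆; All-resp-⊆; ++⁺ˡ)
open import Data.List.Relation.Unary.All as All using (All; []; _∷_)
open import Data.List.Relation.Unary.AllPairs as AllPairs using (AllPairs; []; _∷_)
import Data.List.Relation.Unary.AllPairs.Properties as AllPairs
open import Data.List.Relation.Unary.Any as Any using (here; there)
open import Data.List.Relation.Unary.Unique.Propositional using (Unique)
import Data.List.Relation.Unary.Unique.Propositional.Properties as Unique
open import Data.Nat using (zero; suc; _+_; z≤n; s≤s)
open import Data.Nat.Combinatorics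
  using (_C_; nCk+nC[k+1]≡[n+1]C[k+1]; k>n⇒nCk≡0; nCk≡nC[n∸k]; nCn≡1)
open import Data.Nat.Properties hiding (_≟_)
open import Data.Product using (∃; _,_; proj₁; proj₂; map₂)
open import Data.Product.Properties using (≡-dec)
open import Data.Sum using (_⊎_; inj₁; inj₂)
import Data.Sum as Sum
open import Data.Unit using (tt)
import Data.Vec.Functional as Vector
open import Data.Vec.Functional.Properties using (updateAt-updates; updateAt-minimal)
open import Function using (_∘_; id; case_of_)
open import Function.Definitions using (Injective)
open import Relation.Binary.Definitions using (DecidableEquality)
open import Relation.Binary.PropositionalEquality hiding ([_])
import Relation.Nullary.Decidable as Dec
open import Relation.Nullary using (¬_; Dec; yes; no; contradiction; ¬?)

private
  variable
    A : Set

-- Finite lists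

AllPairs-resp-⊆ : ∀ {R : A → A → Set} {xs ys} → xs ⊆ ys → AllPairs R ys → AllPairs R xs
AllPairs-resp-⊆ []         []         = []
AllPairs-resp-⊆ (y ∷ʳ s)   (_ ∷ ps)   = AllPairs-resp-⊆ s ps
AllPairs-resp-⊆ (refl ∷ s) (p ∷ ps)   = All-resp-⊆ s p ∷ AllPairs-resp-⊆ s ps

AllPairs-++⁻ : ∀ {R : A → A → Set} xs {ys} → AllPairs R (xs ++ ys) →
               ∀ {x y} → x ∈ xs → y ∈ ys → R x y
AllPairs-++⁻ (x ∷ xs) (p ∷ ps) (here refl) y∈ = All.lookup p (∈-++⁺ʳ xs y∈)
AllPairs-++⁻ (x ∷ xs) (p ∷ ps) (there x∈)  y∈ = AllPairs-++⁻ xs ps x∈ y∈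

module _ (_≟ᴬ_ : DecidableEquality A) where

  private
    _≢?_ : (y x : A) → Dec (y ≢ x)
    y ≢? x = ¬? (y ≟ᴬ x)

  length-remove-< : ∀ {x} xs → x ∈ xs → length (filter (_≢? x) xs) < length xs
  length-remove-< xs x∈ = filter-notAll (_≢? _) xs (Any.map (λ { refl x≢x → x≢x refl }) x∈)

  Unique⇒length-≤ : ∀ {xs} → Unique xs → ∀ ys → (∀ {x} → x ∈ xs → x ∈ ys) → length xs ≤ length ys
  Unique⇒length-≤ []                 ys inc = z≤n
  Unique⇒length-≤ {x ∷ xs} (x≢ ∷ uq) ys inc = ≤-<-trans
    (Unique⇒length-≤ uq (filter (_≢? x) ys)
      (λ v∈ → ∈-filter⁺ (_≢? x) (inc (there v∈)) (λ v≡x → All.lookup x≢ v∈ (sym v≡x))))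
    (length-remove-< ys (inc (here refl)))

  -- Pads the images of at most `d` neighbours to a sublist of exactly `d` entries, the only size
  -- for which common neighbours are provided. An entry of `ys` is kept if it occurs in `xs` and
  -- otherwise skipped, until skipping would leave too few entries; then all that remain are taken.
  sublist-through : ∀ d xs ys → length xs ≤ d → d ≤ length ys → (∀ {x} → x ∈ xs → x ∈ ys) →
                    ∃ λ D → D ⊆ ys × length D ≡ d × (∀ {x} → x ∈ xs → x ∈ D)
  sublist-through zero    []       ys       _   _   _   = [] , minimum ys , refl , λ ()
  sublist-through (suc d) xs       (y ∷ ys) |xs|≤ d≤ inc with DecMembership._∈?_ _≟ᴬ_ y xs
  ... | yes y∈xs =
    let D , D⊆ , |D| , xs⊆D = sublist-through d (filter (_≢? y) xs) ys
          (≤-pred (<-≤-trans (length-remove-< xs y∈xs) |xs|≤)) (≤-pred d≤)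
          (λ x∈ → let x∈xs , x≢y = ∈-filter⁻ (_≢? y) x∈ in Any.tail x≢y (inc x∈xs))
    in y ∷ D , refl ∷ D⊆ , cong suc |D| , λ {x} x∈ → case x ≟ᴬ y of λ where
         (yes x≡y) → here x≡y
         (no  x≢y) → there (xs⊆D (∈-filter⁺ (_≢? y) x∈ x≢y))
  ... | no y∉xs with suc d ≤? length ys
  ...   | yes d<|ys| =
    let D , D⊆ , |D| , xs⊆D = sublist-through (suc d) xs ys |xs|≤ d<|ys|
          (λ x∈ → Any.tail (λ { refl → y∉xs x∈ }) (inc x∈))
    in D , y ∷ʳ D⊆ , |D| , xs⊆D
  ...   | no  d≮|ys| = y ∷ ys , ⊆-refl , ≤-antisym (≰⇒> d≮|ys|) d≤ , inc

combinations : ℕ → List A → List (List A)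
combinations zero    xs       = [ [] ]
combinations (suc k) []       = []
combinations (suc k) (x ∷ xs) = map (x ∷_) (combinations k xs) ++ combinations (suc k) xs

length-combinations : ∀ k (xs : List A) → length (combinations k xs) ≡ length xs C k
length-combinations zero    xs       = sym (trans (nCk≡nC[n∸k] {0} {length xs} z≤n) (nCn≡1 (length xs)))
length-combinations (suc k) []       = sym (k>n⇒nCk≡0 {0} {suc k} (s≤s z≤n))
length-combinations (suc k) (x ∷ xs) = begin
  length (map (x ∷_) (combinations k xs) ++ combinations (suc k) xs)
    ≡⟨ length-++ (map (x ∷_) (combinations k xs)) ⟩
  length (map (x ∷_) (combinations k xs)) + length (combinations (suc k) xs)
    ≡⟨ cong₂ _+_ (trans (length-map (x ∷_) (combinations k xs)) (length-combinations k xs))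
                 (length-combinations (suc k) xs) ⟩
  length xs C k + length xs C suc k
    ≡⟨ nCk+nC[k+1]≡[n+1]C[k+1] (length xs) k ⟩
  suc (length xs) C suc k ∎
  where open ≡-Reasoning

∈-combinations⁺ : ∀ {K xs : List A} → K ⊆ xs → K ∈ combinations (length K) xs
∈-combinations⁺ {K = []}    _                       = here refl
∈-combinations⁺ {K = x ∷ K} (refl ∷ s)              = ∈-++⁺ˡ (∈-map⁺ (x ∷_) (∈-combinations⁺ s))
∈-combinations⁺ {K = x ∷ K} {xs = y ∷ ys} (.y ∷ʳ s) =
  ∈-++⁺ʳ (map (y ∷_) (combinations (length K) ys)) (∈-combinations⁺ s)

∈-combinations⁻ : ∀ k {K xs : List A} → K ∈ combinations k xs → K ⊆ xs × length K ≡ k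
∈-combinations⁻ zero    {xs = xs}     (here refl) = minimum xs , refl
∈-combinations⁻ (suc k) {xs = x ∷ xs} K∈ with ∈-++⁻ (map (x ∷_) (combinations k xs)) K∈
... | inj₂ K∈′ = let K⊆ , |K| = ∈-combinations⁻ (suc k) K∈′ in x ∷ʳ K⊆ , |K|
... | inj₁ K∈′ with ∈-map⁻ (x ∷_) K∈′
...   | K′ , K′∈ , refl = let K⊆ , |K| = ∈-combinations⁻ k K′∈ in refl ∷ K⊆ , cong suc |K|

-- Ramsey's theorem

-- The predicate at an entry may depend on the entries after it, as the colour of an entry in a
-- Ramsey chain does.
data AllTails (Q : A → List A → Set) : List A → Set where
  []  : AllTails Q []
  _∷_ : ∀ {x xs} → Q x xs → AllTails Q xs → AllTails Q (x ∷ xs)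

Antitone : (A → List A → Set) → Set
Antitone Q = ∀ {x ys zs} → ys ⊆ zs → Q x zs → Q x ys

AllTails-map : ∀ {Q R : A → List A → Set} → (∀ {x xs} → Q x xs → R x xs) →
               ∀ {xs} → AllTails Q xs → AllTails R xs
AllTails-map f []       = []
AllTails-map f (p ∷ ps) = f p ∷ AllTails-map f ps

-- Dividing the list in two deletes entries from every tail, which antitone predicates survive.
AllTails-split : ∀ {Q R : A → List A → Set} → Antitone Q → Antitone R → ∀ {xs} →
                 AllTails (λ x ys → Q x ys ⊎ R x ys) xs →
                 ∃ λ ys → ∃ λ zs → ys ⊆ xs × zs ⊆ xs × AllTails Q ys × AllTails R zs ×
                   length xs ≡ length ys + length zs
AllTails-split antiQ antiR [] = [] , [] , [] , [] , [] , [] , refl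
AllTails-split antiQ antiR {x ∷ _} (p ∷ ps) with AllTails-split antiQ antiR ps | p
... | ys , zs , ys⊆ , zs⊆ , Qys , Rzs , eq | inj₁ q =
  x ∷ ys , zs , refl ∷ ys⊆ , x ∷ʳ zs⊆ , antiQ ys⊆ q ∷ Qys , Rzs , cong suc eq
... | ys , zs , ys⊆ , zs⊆ , Qys , Rzs , eq | inj₂ r =
  ys , x ∷ zs , x ∷ʳ ys⊆ , refl ∷ zs⊆ , Qys , antiR zs⊆ r ∷ Rzs ,
  trans (cong suc eq) (sym (+-suc (length ys) (length zs)))

-- Split off the entries of colour zero. If at most `d` of them exist, more than `r * d` entries
-- remain for the other `r` colours.
pigeonhole : ∀ r d {Q : Fin r → A → List A → Set} → (∀ {c} → Antitone (Q c)) → ∀ {xs} →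
             AllTails (λ x ys → ∃ λ c → Q c x ys) xs → r * d < length xs →
             ∃ λ c → ∃ λ ys → ys ⊆ xs × d < length ys × AllTails (Q c) ys
pigeonhole zero    d     anti ((() , _) ∷ _) _
pigeonhole (suc r) d {Q} anti {xs} all r*d<
  with AllTails-split {Q = Q zero} {R = λ x ys → ∃ λ c → Q (suc c) x ys}
         anti (λ s → map₂ (anti s))
         (AllTails-map (λ { (zero , q) → inj₁ q ; (suc c , q) → inj₂ (c , q) }) all)
... | ys , zs , ys⊆ , zs⊆ , Qys , Rzs , eq with suc d ≤? length ys
...   | yes d< = zero , ys , ys⊆ , d< , Qys
...   | no  d≮ =
  let c , vs , vs⊆ , d< , Qvs = pigeonhole r d anti Rzs r*d<|zs|
  in suc c , vs , ⊆-trans vs⊆ zs⊆ , d< , Qvs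
  where
  r*d<|zs| : r * d < length zs
  r*d<|zs| = +-cancelˡ-< d (r * d) (length zs) (begin-strict
    d + r * d             <⟨ r*d< ⟩
    length xs             ≡⟨ eq ⟩
    length ys + length zs ≤⟨ +-monoˡ-≤ (length zs) (≮⇒≥ d≮) ⟩
    d + length zs         ∎)
    where open ≤-Reasoning

mutual
  -- The Erdős-Rado recursion. A chain of `suc (r * N)` entries, each with a colour of its own, has
  -- more than `N` entries of one colour.
  ramseyNumber : ℕ → ℕ → ℕ → ℕ
  ramseyNumber zero    r N = N
  ramseyNumber (suc k) r N = chainNumber k r (suc (r * N))

  chainNumber : ℕ → ℕ → ℕ → ℕ
  chainNumber k r zero    = zero
  chainNumber k r (suc m) = suc (ramseyNumber k r (chainNumber k r m))

Homogeneous : ℕ → (List A → Set) → List A → Set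
Homogeneous k P xs = ∀ K → K ⊆ xs → length K ≡ k → P K

Homogeneous-antitone : ∀ {k} {P : A → List A → Set} → Antitone (λ x → Homogeneous k (P x))
Homogeneous-antitone ys⊆ hom K K⊆ = hom K (⊆-trans K⊆ ys⊆)

mutual
  -- In a chain the colour of a `suc k`-sublist is determined by its first entry, so entries of the
  -- same colour span a homogeneous list. A colouring is a total relation, and a sublist may have
  -- several colours.
  ramsey : ∀ k {r} N {P : Fin r → List A → Set} → (∀ K → ∃ λ c → P c K) →
           ∀ xs → ramseyNumber k r N ≤ length xs →
           ∃ λ ys → ys ⊆ xs × N ≤ length ys ×
             ∃ λ c → Homogeneous k (P c) ys
  ramsey zero    N {P} colour xs N≤ =
    let c , Pc[] = colour [] in xs , ⊆-refl , N≤ , c , λ { [] _ _ → Pc[] }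
  ramsey (suc k) {r} N {P} colour xs m≤ =
    let ys , ys⊆ , |ys| , all = ramsey-chain k (suc (r * N)) colour xs m≤
        c , zs , zs⊆ , N< , mono =
          pigeonhole r N (λ {c} → Homogeneous-antitone {P = λ x K → P c (x ∷ K)}) all |ys|
    in zs , ⊆-trans zs⊆ ys⊆ , <⇒≤ N< , c , homogeneous mono
    where
    homogeneous : ∀ {c zs} → AllTails (λ x → Homogeneous k (λ K → P c (x ∷ K))) zs →
                  Homogeneous (suc k) (P c) zs
    homogeneous (_ ∷ ps) K       (_ ∷ʳ s)   eq = homogeneous ps K s eq
    homogeneous (p ∷ _)  (_ ∷ K) (refl ∷ s) eq = p K s (suc-injective eq)

  -- The head `x` colours the `k`-sublists `K` of the rest by the colour of `x ∷ K`. The chain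
  -- continues inside a list homogeneous for this colouring, so `x` keeps its colour.
  ramsey-chain : ∀ k {r} m {P : Fin r → List A → Set} → (∀ K → ∃ λ c → P c K) →
                 ∀ xs → chainNumber k r m ≤ length xs →
                 ∃ λ ys → ys ⊆ xs × m ≤ length ys ×
                   AllTails (λ x zs → ∃ λ c → Homogeneous k (λ K → P c (x ∷ K)) zs) ys
  ramsey-chain k zero    colour xs       _        = [] , minimum xs , z≤n , []
  ramsey-chain k {r} (suc m) colour (x ∷ xs) (s≤s m≤) =
    let ys , ys⊆ , |ys| , c , mono =
          ramsey k (chainNumber k r m) (λ K → colour (x ∷ K)) xs m≤
        zs , zs⊆ , |zs| , all = ramsey-chain k m colour ys |ys|
    in x ∷ zs , refl ∷ ⊆-trans zs⊆ ys⊆ , s≤s |zs| ,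
       (c , λ K K⊆ → mono K (⊆-trans K⊆ zs⊆)) ∷ all

-- Game trees

-- A Builder strategy as a well-founded tree branching over Painter's answers: every branch is
-- finite, and its length may depend on those answers.
data Forces {q : ℕ} (Q : History q → Set) (h : History q) : Set where
  done : Q h → Forces Q h
  step : ∀ e → Legal h e → (∀ c → Forces Q (h ++ [ e , c ])) → Forces Q h

module _ {q : ℕ} where

  _>>=_ : ∀ {Q R : History q → Set} {h} → Forces Q h → (∀ {h′} → Q h′ → Forces R h′) → Forces R h
  done Qh        >>= next = next Qh
  step e legal k >>= next = step e legal (λ c → k c >>= next)

  -- Only the colours of the history are read: in a play of this strategy the edges are those that
  -- the tree prescribes.
  follow : ∀ {Q : History q → Set} {h} → Forces Q h → Builder q
  -- A default move for positions in which the goal has been reached.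
  follow (done _)     _              = 0 , 0
  follow (step e _ k) []             = e
  follow (step e _ k) ((_ , c) ∷ h) = follow (k c) h

  -- Stated from any time `t₀` on, with `B` agreeing with the tree only on continuations of `h`, so
  -- that the induction can descend into a subtree while `B` stays fixed.
  follow-wins : ∀ {Q : History q → Set} (B : Builder q) (P : Painter q) {h} (F : Forces Q h) t₀ →
                play B P t₀ ≡ h → (∀ h′ → B (h ++ h′) ≡ follow F h′) →
                ∃ λ T → Q (play B P T) × (∀ t → t₀ ≤ t → t < T → Legal (play B P t) (B (play B P t)))
  follow-wins B P (done Qh) t₀ refl agree =
    t₀ , Qh , λ t t₀≤t t<t₀ → contradiction t<t₀ (≤⇒≯ t₀≤t)
  follow-wins {Q} B P {h} (step e legal k) t₀ refl agree =
    let T , won , legals = follow-wins B P (k c) (suc t₀) playₛ agreeₛ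
    in T , won , λ t t₀≤t t<T → case m≤n⇒m<n∨m≡n t₀≤t of λ where
         (inj₁ t₀<t) → legals t t₀<t t<T
         (inj₂ refl) → subst (Legal h) (sym Bh≡e) legal
    where
    c : Fin q
    c = P h e
    Bh≡e : B h ≡ e
    Bh≡e = trans (cong B (sym (++-identityʳ h))) (agree [])
    playₛ : play B P (suc t₀) ≡ h ++ [ e , c ]
    playₛ = cong (λ x → h ++ [ x , P h x ]) Bh≡e
    agreeₛ : ∀ h′ → B ((h ++ [ e , c ]) ++ h′) ≡ follow (k c) h′
    agreeₛ h′ = trans (cong B (++-assoc h [ e , c ] h′)) (agree ((e , c) ∷ h′))

  exposed-snoc⁺ : ∀ (h : History q) {m x} → x ∈ exposed h → x ∈ exposed (h ++ [ m ])
  exposed-snoc⁺ h {m} x∈ = subst (_ ∈_) (sym (map-++ proj₁ h [ m ])) (∈-++⁺ˡ x∈)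

  exposed-snoc⁻ : ∀ (h : History q) {m x} → x ∈ exposed (h ++ [ m ]) → x ∈ exposed h ⊎ x ≡ proj₁ m
  exposed-snoc⁻ h {m} x∈ with ∈-++⁻ (exposed h) (subst (_ ∈_) (map-++ proj₁ h [ m ]) x∈)
  ... | inj₁ x∈h         = inj₁ x∈h
  ... | inj₂ (here x≡)   = inj₂ x≡

  exposed-play-mono : ∀ (B : Builder q) (P : Painter q) {t} T → t ≤ T →
                      ∀ {x} → x ∈ exposed (play B P t) → x ∈ exposed (play B P T)
  exposed-play-mono B P {t} T t≤T x∈ with m≤n⇒m<n∨m≡n t≤T
  ... | inj₂ refl = x∈
  exposed-play-mono B P (suc T) _ x∈ | inj₁ (s≤s t≤T) =
    exposed-snoc⁺ (play B P T) (exposed-play-mono B P T t≤T x∈)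

-- Sparse graphs

-- The out-degree is bounded by a covering list, so repeated entries of `E` do no harm.
record Sparse (k M : ℕ) (E : List (ℕ × ℕ)) : Set where
  field
    increasing : ∀ {w z} → (w , z) ∈ E → w < z × z < M
    out        : ∀ w → ∃ λ K → length K ≤ k × (∀ {z} → (w , z) ∈ E → z ∈ K)

open Sparse

Sparse-antitone : ∀ {k M E E′} → (∀ {e} → e ∈ E → e ∈ E′) → Sparse k M E′ → Sparse k M E
Sparse-antitone E⊆ S .increasing e∈ = S .increasing (E⊆ e∈)
Sparse-antitone E⊆ S .out w = let K , |K| , out⊆ = S .out w in K , |K| , λ e∈ → out⊆ (E⊆ e∈)

upTo-increasing : ∀ M → AllPairs _<_ (upTo M)
upTo-increasing M = AllPairs.applyUpTo⁺₁ id M (λ i<j _ → i<j)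

-- `OrderOK` reads its list latest vertex first, so `upTo M` stands for the order by decreasing
-- number. The earlier neighbours of `v` are larger than `v`, hence ends of edges recorded as
-- leaving `v`.
Sparse⇒Degenerate : ∀ {k M E} → Sparse k M E → Degenerate _≟_ k E
Sparse⇒Degenerate {k} {M} {E} S =
  upTo M , Unique.upTo⁺ M ,
  (λ e∈ → let w<z , z<M = S .increasing e∈ in ∈-upTo⁺ (<-trans w<z z<M) , ∈-upTo⁺ z<M) ,
  orderOK (upTo-increasing M)
  where
  orderOK : ∀ {L} → AllPairs _<_ L → OrderOK _≟_ k E L
  orderOK []                      = tt
  orderOK {v ∷ L} (v< ∷ sorted) =
    let K , |K| , out⊆ = S .out v
        adj = λ u → adj? _≟_ E u v
        nbr∈K : ∀ {u} → u ∈ filter adj L → u ∈ K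
        nbr∈K u∈ = case ∈-filter⁻ adj u∈ of λ where
          (u∈L , inj₂ vu) → out⊆ vu
          (u∈L , inj₁ uv) → contradiction (S .increasing uv .proj₁) (<⇒≯ (All.lookup v< u∈L))
    in ≤-trans (Unique⇒length-≤ _≟_ (AllPairs.filter⁺ adj (AllPairs.map <⇒≢ sorted)) K nbr∈K) |K| ,
       orderOK sorted

-- The vertices of `R` have their whole allowance of outgoing edges left.
Sources∉ : List (ℕ × ℕ) → List ℕ → Set
Sources∉ E R = ∀ {w z} → (w , z) ∈ E → w ∉ R

-- Joining vertices to sets

module _ {q : ℕ} where

  infix 4 _≼_
  _≼_ : History q → History q → Set
  h ≼ h′ = ∀ {m} → m ∈ h → m ∈ h′

  Joined : History q → ℕ → List ℕ → Set
  Joined h w K = ∀ {z} → z ∈ K → ∃ λ c → ((w , z) , c) ∈ h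

  record JoinOne (h : History q) (w : ℕ) (K : List ℕ) (h′ : History q) : Set where
    field
      grow   : h ≼ h′
      new    : ∀ {e} → e ∈ exposed h′ → e ∈ exposed h ⊎ (proj₁ e ≡ w × proj₂ e ∈ K)
      joined : Joined h′ w K

  -- A move keeps the remaining ones legal: `K` has no repetitions, and a reversed pair could only
  -- coincide with the new edge if `w` were in `K`.
  joinOne : ∀ h w {K} → Unique K → (∀ {z} → z ∈ K → Legal h (w , z)) → Forces (JoinOne h w K) h
  joinOne h w []                  legal = done record { grow = id ; new = inj₁ ; joined = λ () }
  joinOne h w {z ∷ K} (z≢ ∷ uniq) legal = step (w , z) (legal (here refl)) λ c →
    joinOne (h ++ [ (w , z) , c ]) w uniq legalₛ >>= λ J → done record
      { grow   = JoinOne.grow J ∘ ∈-++⁺ˡ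
      ; new    = λ e∈ → case JoinOne.new J e∈ of λ where
          (inj₂ (e₁ , e₂)) → inj₂ (e₁ , there e₂)
          (inj₁ e∈h⁺)      → Sum.map₂ (λ { refl → refl , here refl }) (exposed-snoc⁻ h e∈h⁺)
      ; joined = λ where
          (here refl) → c , JoinOne.grow J (∈-++⁺ʳ h (here refl))
          (there z∈)  → JoinOne.joined J z∈
      }
    where
    legalₛ : ∀ {c y} → y ∈ K → Legal (h ++ [ (w , z) , c ]) (w , y)
    legalₛ {y = y} y∈ with legal (there y∈)
    ... | w≢y , fresh = w≢y , λ where
      (inj₁ wy) → case exposed-snoc⁻ h wy of λ where
        (inj₁ wy∈)  → fresh (inj₁ wy∈)
        (inj₂ refl) → All.lookup z≢ y∈ refl
      (inj₂ yw) → case exposed-snoc⁻ h yw of λ where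
        (inj₁ yw∈)  → fresh (inj₂ yw∈)
        (inj₂ refl) → w≢y refl

  record JoinAll (k M : ℕ) (h : History q) (W : List ℕ) (Ks : List (List ℕ)) (Z : List ℕ)
                 (h′ : History q) : Set where
    field
      grow    : h ≼ h′
      sparse  : Sparse k M (exposed h′)
      sources : Sources∉ (exposed h′) Z
      joined  : ∀ {K} → K ∈ Ks → ∃ λ w → w ∈ W × Joined h′ w K

  -- Each set uses up the head of `W`. That head was no source before, so its edges are new; the
  -- rest of `W` and all of `Z` stay free of outgoing edges.
  joinAll : ∀ {k M} h W Ks Z → length Ks ≤ length W →
            AllPairs _<_ (W ++ Z) → (∀ {z} → z ∈ Z → z < M) →
            (∀ {K} → K ∈ Ks → K ⊆ Z × length K ≡ k) →
            Sparse k M (exposed h) → Sources∉ (exposed h) (W ++ Z) →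
            Forces (JoinAll k M h W Ks Z) h
  joinAll h W [] Z _ sorted Z<M sub sparse sources = done record
    { grow = id ; sparse = sparse ; sources = λ e∈ → sources e∈ ∘ ∈-++⁺ʳ W ; joined = λ () }
  joinAll {k} {M} h (w ∷ W) (K ∷ Ks) Z (s≤s |Ks|≤) (w< ∷ sorted) Z<M sub sparse sources =
    joinOne h w uniqueK legal >>= λ {h₁} J →
    joinAll h₁ W Ks Z |Ks|≤ sorted Z<M (sub ∘ there) (sparse₁ J) (sources₁ J) >>= λ J′ → done record
      { grow    = JoinAll.grow J′ ∘ JoinOne.grow J
      ; sparse  = JoinAll.sparse J′
      ; sources = JoinAll.sources J′
      ; joined  = λ where
          (here refl) → w , here refl , λ z∈ → map₂ (JoinAll.grow J′) (JoinOne.joined J z∈)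
          (there K∈)  → let w′ , w′∈ , j = JoinAll.joined J′ K∈ in w′ , there w′∈ , j
      }
    where
    K⊆Z : K ⊆ Z
    K⊆Z = sub (here refl) .proj₁
    w<K : ∀ {z} → z ∈ K → w < z
    w<K z∈ = All.lookup w< (∈-++⁺ʳ W (lookup K⊆Z z∈))
    uniqueK : Unique K
    uniqueK = AllPairs.map <⇒≢ (AllPairs-resp-⊆ (++⁺ˡ W K⊆Z) sorted)
    legal : ∀ {z} → z ∈ K → Legal h (w , z)
    legal z∈ = <⇒≢ (w<K z∈) , λ where
      (inj₁ wz) → sources wz (here refl)
      (inj₂ zw) → <⇒≯ (w<K z∈) (sparse .increasing zw .proj₁)
    module _ {h₁} (J : JoinOne h w K h₁) where
      sources₁ : Sources∉ (exposed h₁) (W ++ Z)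
      sources₁ e∈ v∈ = case JoinOne.new J e∈ of λ where
        (inj₁ old)       → sources old (there v∈)
        (inj₂ (refl , _)) → <-irrefl refl (All.lookup w< v∈)
      sparse₁ : Sparse k M (exposed h₁)
      sparse₁ .increasing e∈ = case JoinOne.new J e∈ of λ where
        (inj₁ old)         → sparse .increasing old
        (inj₂ (refl , z∈)) → w<K z∈ , Z<M (lookup K⊆Z z∈)
      sparse₁ .out v with v ≟ w
      -- Before this round nothing left `w`, so `K` covers all its outgoing edges.
      ... | yes refl = K , ≤-reflexive (sub (here refl) .proj₂) , λ e∈ → case JoinOne.new J e∈ of λ where
        (inj₁ old)      → contradiction (here refl) (sources old)
        (inj₂ (_ , z∈)) → z∈
      ... | no v≢w = let K′ , |K′| , out⊆ = sparse .out v in K′ , |K′| , λ e∈ → case JoinOne.new J e∈ of λ where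
        (inj₁ old)       → out⊆ old
        (inj₂ (v≡w , _)) → contradiction v≡w v≢w

-- Embeddings of the target graph

module _ (G : Graph) where

  private
    Vertex : Set
    Vertex = Fin (n G)

  -- The given order may omit isolated vertices. They are added as latest vertices, where they have
  -- no earlier neighbours.
  degeneracyOrder : ∀ {d} → DegenerateGraph d G →
                    ∃ λ L → Unique L × (∀ v → v ∈ L) × OrderOK Fin._≟_ d (edges G) L
  degeneracyOrder {d} (L , uniqueL , covers , orderOK) =
    let L′ , unique′ , _ , all , orderOK′ = insert (allFin (n G))
    in L′ , unique′ , (λ v → all (∈-allFin v)) , orderOK′
    where
    insert : ∀ vs → ∃ λ L′ → Unique L′ × (∀ {v} → v ∈ L → v ∈ L′) × (∀ {v} → v ∈ vs → v ∈ L′) ×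
             OrderOK Fin._≟_ d (edges G) L′
    insert [] = L , uniqueL , id , (λ ()) , orderOK
    insert (v ∷ vs) with insert vs
    ... | L′ , unique′ , L⊆ , vs⊆ , orderOK′ with DecMembership._∈?_ Fin._≟_ v L′
    ...   | yes v∈ = L′ , unique′ , L⊆ , (λ { (here refl) → v∈ ; (there x∈) → vs⊆ x∈ }) , orderOK′
    ...   | no  v∉ =
      v ∷ L′ ,
      All.tabulate (λ { x∈ refl → v∉ x∈ }) ∷ unique′ ,
      there ∘ L⊆ ,
      (λ { (here refl) → here refl ; (there x∈) → there (vs⊆ x∈) }) ,
      subst (λ xs → length xs ≤ d) (sym noNeighbours) z≤n ,
      orderOK′
      where
      noNeighbours : filter (λ u → adj? Fin._≟_ (edges G) u v) L′ ≡ []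
      noNeighbours = filter-none (λ u → adj? Fin._≟_ (edges G) u v) {xs = L′} (All.tabulate λ where
        _ (inj₁ uv) → v∉ (L⊆ (covers uv .proj₂))
        _ (inj₂ vu) → v∉ (L⊆ (covers vu .proj₁)))

  InjectiveOn : List Vertex → (Vertex → ℕ) → Set
  InjectiveOn B g = ∀ {u v} → u ∈ B → v ∈ B → g u ≡ g v → u ≡ v

  module _ {q : ℕ} where

    Coloured : History q → Fin q → ℕ → ℕ → Set
    Coloured h c x y = ((x , y) , c) ∈ h ⊎ ((y , x) , c) ∈ h

    -- All injections are allowed, so the images of `B` can be chosen later and in a smaller
    -- reservoir. Values of `g` outside `B` carry no information.
    Rich : List Vertex → Fin q → History q → List ℕ → Set
    Rich B c h R = ∀ g → (∀ {v} → v ∈ B → g v ∈ R) → InjectiveOn B g →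
      ∃ λ f → (∀ {v} → v ∈ B → f v ≡ g v) × Injective _≡_ _≡_ f ×
        (∀ {a b} → (a , b) ∈ edges G → (a ∈ B × b ∈ B) ⊎ Coloured h c (f a) (f b))

    CommonNeighbour : History q → List ℕ → Fin q → List ℕ → Set
    CommonNeighbour h W c D = ∃ λ w → w ∈ W × All (λ z → ((w , z) , c) ∈ h) D

    commonNeighbour? : ∀ h W c D → Dec (CommonNeighbour h W c D)
    commonNeighbour? h W c D = Dec.map′
      find (λ (w , w∈ , all) → lose w∈ all)
      (Any.any? (λ w → All.all? (λ z → ((w , z) , c) ∈ᴴ? h) D) W)
      where open DecMembership (≡-dec (≡-dec _≟_ _≟_) Fin._≟_) using () renaming (_∈?_ to _∈ᴴ?_)

    Rich-initial : ∀ {B c h R} → (∀ v → v ∈ B) → Rich B c h R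
    Rich-initial all g _ inj = g , (λ _ → refl) , inj (all _) (all _) , λ _ → inj₁ (all _ , all _)

    Rich-mono : ∀ {B c h h′ R R′} → h ≼ h′ → (∀ {x} → x ∈ R′ → x ∈ R) → Rich B c h R → Rich B c h′ R′
    Rich-mono h≼ R′⊆ rich g gB inj =
      let f , f≡g , f-inj , col = rich g (R′⊆ ∘ gB) inj
      in f , f≡g , f-inj , λ e∈ → Sum.map₂ (Sum.map h≼ h≼) (col e∈)

    Rich[]⇒MonoCopy : ∀ {c h R} → Rich [] c h R → MonoCopy G h
    Rich[]⇒MonoCopy {c} rich =
      -- The constant `0` is a filler, since no value is prescribed on an empty part.
      let f , _ , f-inj , col = rich (λ _ → 0) (λ ()) (λ ())
      in c , f , f-inj , All.tabulate (λ e∈ → case col e∈ of λ { (inj₂ p) → p })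

    -- Given images of `B` in `Z`, the removed vertex `u` goes to a common `c`-neighbour `w` of the
    -- images of its at most `d` earlier neighbours. As `w` lies below `Z`, injectivity persists,
    -- and the edges from `u` to `B` get colour `c`.
    Rich-tail : ∀ {d c h R} W Z B → (∀ {w} → w ∈ W → w ∈ R) → (∀ {z} → z ∈ Z → z ∈ R) →
                (∀ {w z} → w ∈ W → z ∈ Z → w < z) → d ≤ length Z →
                Homogeneous d (CommonNeighbour h W c) Z →
                Unique B → OrderOK Fin._≟_ d (edges G) B →
                Rich B c h R → Rich (drop 1 B) c h Z
    Rich-tail W Z []      W⊆ Z⊆ W<Z d≤ common _          _           rich = Rich-mono id Z⊆ rich
    Rich-tail {d} {c} {h} {R} W Z (u ∷ B) W⊆ Z⊆ W<Z d≤ common (u∉B ∷ _) (few , _) rich g gB inj =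
      f , f≡g , f-inj , coloured
      where
      adj : ∀ v → Dec (Adj (edges G) v u)
      adj v = adj? Fin._≟_ (edges G) v u

      through : ∃ λ D → D ⊆ Z × length D ≡ d × (∀ {x} → x ∈ map g (filter adj B) → x ∈ D)
      through = sublist-through _≟_ d (map g (filter adj B)) Z
        (subst (_≤ d) (sym (length-map g (filter adj B))) few) d≤
        (λ x∈ → case ∈-map⁻ g x∈ of λ { (v , v∈ , refl) → gB (∈-filter⁻ adj v∈ .proj₁) })

      D : List ℕ
      D = through .proj₁

      neighbour : CommonNeighbour h W c D
      neighbour = let _ , D⊆ , |D| , _ = through in common D D⊆ |D|

      w : ℕ
      w = neighbour .proj₁

      w∈W : w ∈ W
      w∈W = neighbour .proj₂ .proj₁

      w-joined : ∀ {v} → v ∈ B → Adj (edges G) v u → ((w , g v) , c) ∈ h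
      w-joined v∈ vu = All.lookup (neighbour .proj₂ .proj₂)
        (through .proj₂ .proj₂ .proj₂ (∈-map⁺ g (∈-filter⁺ adj v∈ vu)))

      g′ : Vertex → ℕ
      g′ = Vector.updateAt g u (λ _ → w)

      g′u : g′ u ≡ w
      g′u = updateAt-updates u g

      g′v : ∀ {v} → v ∈ B → g′ v ≡ g v
      g′v {v} v∈ = updateAt-minimal v u g (λ v≡u → All.lookup u∉B v∈ (sym v≡u))

      w≢g : ∀ {v} → v ∈ B → g′ u ≢ g′ v
      w≢g v∈ eq = <⇒≢ (W<Z w∈W (gB v∈)) (trans (sym g′u) (trans eq (g′v v∈)))

      g′B : ∀ {v} → v ∈ u ∷ B → g′ v ∈ R
      g′B (here refl) = subst (_∈ R) (sym g′u) (W⊆ w∈W)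
      g′B (there v∈)  = subst (_∈ R) (sym (g′v v∈)) (Z⊆ (gB v∈))

      g′-inj : InjectiveOn (u ∷ B) g′
      g′-inj (here refl) (here refl) _  = refl
      g′-inj (here refl) (there v∈)  eq = contradiction eq (w≢g v∈)
      g′-inj (there v∈)  (here refl) eq = contradiction (sym eq) (w≢g v∈)
      g′-inj (there a∈)  (there b∈)  eq = inj a∈ b∈ (trans (sym (g′v a∈)) (trans eq (g′v b∈)))

      embedding = rich g′ g′B g′-inj

      f : Vertex → ℕ
      f = embedding .proj₁

      f-inj : Injective _≡_ _≡_ f
      f-inj = embedding .proj₂ .proj₂ .proj₁

      fu : f u ≡ w
      fu = trans (embedding .proj₂ .proj₁ (here refl)) g′u

      f≡g : ∀ {v} → v ∈ B → f v ≡ g v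
      f≡g v∈ = trans (embedding .proj₂ .proj₁ (there v∈)) (g′v v∈)

      edge-u : ∀ {v} → v ∈ B → Adj (edges G) v u → ((f u , f v) , c) ∈ h
      edge-u v∈ vu = subst₂ (λ x y → ((x , y) , c) ∈ h) (sym fu) (sym (f≡g v∈)) (w-joined v∈ vu)

      coloured : ∀ {a b} → (a , b) ∈ edges G → (a ∈ B × b ∈ B) ⊎ Coloured h c (f a) (f b)
      coloured e∈ = case embedding .proj₂ .proj₂ .proj₂ e∈ of λ where
        (inj₂ col)                     → inj₂ col
        (inj₁ (here refl , here refl)) → contradiction refl (All.lookup (noLoop G) e∈)
        (inj₁ (here refl , there b∈))  → inj₂ (inj₁ (edge-u b∈ (inj₂ e∈)))
        (inj₁ (there a∈  , here refl)) → inj₂ (inj₂ (edge-u a∈ (inj₁ e∈)))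
        (inj₁ (there a∈  , there b∈))  → inj₁ (a∈ , b∈)

-- Builder's strategy

sum : ∀ {q} → (Fin q → ℕ) → ℕ
sum = Vector.foldr _+_ 0

sum-mono-≤ : ∀ {q} {f g : Fin q → ℕ} → (∀ i → f i ≤ g i) → sum f ≤ sum g
sum-mono-≤ {zero}  f≤g = z≤n
sum-mono-≤ {suc q} f≤g = +-mono-≤ (f≤g zero) (sum-mono-≤ (f≤g ∘ suc))

sum-mono-< : ∀ {q} {f g : Fin q → ℕ} → (∀ i → f i ≤ g i) → ∀ i → f i < g i → sum f < sum g
sum-mono-< f≤g zero    lt = +-mono-<-≤ lt (sum-mono-≤ (f≤g ∘ suc))
sum-mono-< f≤g (suc i) lt = +-mono-≤-< (f≤g zero) (sum-mono-< (f≤g ∘ suc) i lt)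

updateAt-elim : ∀ {q} {A : Set} (Φ : Fin q → A → Set) (B : Fin q → A) {f : A → A} i →
                Φ i (f (B i)) → (∀ j → Φ j (B j)) → ∀ j → Φ j (Vector.updateAt B i f j)
updateAt-elim Φ B i Φi Φs j with j Fin.≟ i
... | yes refl = subst (Φ i) (sym (updateAt-updates i B)) Φi
... | no  j≢i  = subst (Φ j) (sym (updateAt-minimal j i B j≢i)) (Φs j)

-- There are suc q colours and the target graph is (suc d)-degenerate.
module Strategy (q d : ℕ) (G : Graph) where

  -- The least number of edges among which `suc q` colours always leave `suc d` of equal colour.
  k : ℕ
  k = suc (suc q * d)

  Colour : Set
  Colour = Fin (suc q)

  -- One colour is added for sets without a common neighbour. The summand `k` makes room for the
  -- `k`-sublist that refutes this colour, and `m` is what the next round requires.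
  ramseySize : ℕ → ℕ
  ramseySize m = ramseyNumber (suc d) (suc (suc q)) (k + m)

  -- A vertex of `W` for each `k`-sublist of `Z`, and `Z` itself.
  size : ℕ → ℕ
  size zero    = 0
  size (suc s) = ramseySize (size s) C k + ramseySize (size s)

  monochromatic : ∀ {h : History (suc q)} {w K} → Joined h w K → length K ≡ k →
                  ∃ λ c → ∃ λ D → D ⊆ K × length D ≡ suc d × All (λ z → ((w , z) , c) ∈ h) D
  monochromatic {h} {w} {K} joined |K| =
    let c , ys , ys⊆ , d< , mono = pigeonhole (suc q) d
          {λ c z _ → ((w , z) , c) ∈ h} (λ _ → id) (tabulate joined) (≤-reflexive (sym |K|))
    in c , take (suc d) ys , ⊆-trans (take-⊆ (suc d) ys) ys⊆ ,
       trans (length-take (suc d) ys) (m≤n⇒m⊓n≡m d<) ,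
       All-resp-⊆ (take-⊆ (suc d) ys) (toAll mono)
    where
    tabulate : ∀ {Q : ℕ → Set} {xs} → (∀ {x} → x ∈ xs → Q x) → AllTails (λ x _ → Q x) xs
    tabulate {xs = []}     p = []
    tabulate {xs = x ∷ xs} p = p (here refl) ∷ tabulate (p ∘ there)
    toAll : ∀ {Q : ℕ → Set} {xs} → AllTails (λ x _ → Q x) xs → All Q xs
    toAll []       = []
    toAll (p ∷ ps) = p ∷ toAll ps

  -- The extra colour zero marks sets without a common neighbour in any colour; since every
  -- k-set is joined to a vertex of W, it cannot be the colour of a large homogeneous set.
  HasColour : History (suc q) → List ℕ → Fin (suc (suc q)) → List ℕ → Set
  HasColour h W zero    D = ∀ c → ¬ CommonNeighbour G h W c D
  HasColour h W (suc c) D = CommonNeighbour G h W c D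

  hasColour : ∀ h W D → ∃ λ c → HasColour h W c D
  hasColour h W D with Fin.any? (λ c → commonNeighbour? G h W c D)
  ... | yes (c , common) = suc c , common
  ... | no  none         = zero , λ c common → none (c , common)

  homogeneous : ∀ {h} W Z m → ramseySize m ≤ length Z →
                (∀ {K} → K ⊆ Z → length K ≡ k → ∃ λ w → w ∈ W × Joined h w K) →
                ∃ λ Y → Y ⊆ Z × k + m ≤ length Y × ∃ λ c →
                  Homogeneous (suc d) (CommonNeighbour G h W c) Y
  homogeneous {h} W Z m size≤ joined =
    case ramsey (suc d) (k + m) (hasColour h W) Z size≤ of λ where
      (Y , Y⊆ , |Y| , suc c , mono) → Y , Y⊆ , |Y| , c , mono
      (Y , Y⊆ , |Y| , zero  , none) →
        let |K|        = trans (length-take k Y) (m≤n⇒m⊓n≡m (≤-trans (m≤m+n k m) |Y|))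
            w , w∈ , j = joined (⊆-trans (take-⊆ k Y) Y⊆) |K|
            c , D , D⊆ , |D| , all = monochromatic j |K|
        in contradiction (w , w∈ , all) (none D (⊆-trans D⊆ (take-⊆ k Y)) |D| c)

  module _ (M : ℕ) where

    Goal : History (suc q) → Set
    Goal h = MonoCopy G h × Sparse k M (exposed h)

    record State (B : Colour → List (Fin (n G))) (R : List ℕ) (h : History (suc q)) : Set where
      field
        unique  : ∀ c → Unique (B c)
        orderOK : ∀ c → OrderOK Fin._≟_ (suc d) (edges G) (B c)
        rich    : ∀ c → Rich G (B c) c h R
        sorted  : AllPairs _<_ R
        bounded : ∀ {z} → z ∈ R → z < M
        sparse  : Sparse k M (exposed h)
        sources : Sources∉ (exposed h) R

    open State

    -- Each round either ends the game or shortens one part `B c`. The inequality is strict because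
    -- an exhausted part is noticed only when its colour comes up again, which can take one round
    -- after all parts are empty.
    forces : ∀ s {B R h} → State B R h → sum (length ∘ B) < s → size s ≤ length R → Forces Goal h
    forces (suc s) {B} {R} {h} st sum< size≤ =
      joinAll h W (combinations k Z) Z |Ks|≤ (subst (AllPairs _<_) (sym W++Z≡R) (st .sorted))
        (st .bounded ∘ Z⊆R) (∈-combinations⁻ k) (st .sparse)
        (subst (Sources∉ (exposed h)) (sym W++Z≡R) (st .sources))
        >>= next
      where
      m : ℕ
      m = ramseySize (size s)
      W Z : List ℕ
      -- As `R` is increasing, cutting off its last `m` entries puts `W` below `Z`.
      W = take (length R ∸ m) R
      Z = drop (length R ∸ m) R
      W++Z≡R : W ++ Z ≡ R
      W++Z≡R = take++drop≡id (length R ∸ m) R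
      W⊆R : ∀ {w} → w ∈ W → w ∈ R
      W⊆R = lookup (take-⊆ (length R ∸ m) R)
      Z⊆R : ∀ {z} → z ∈ Z → z ∈ R
      Z⊆R = lookup (drop-⊆ (length R ∸ m) R)
      |Z| : length Z ≡ m
      |Z| = trans (length-drop (length R ∸ m) R) (m∸[m∸n]≡n (m+n≤o⇒n≤o (m C k) size≤))
      |Ks|≤ : length (combinations k Z) ≤ length W
      |Ks|≤ = begin
        length (combinations k Z) ≡⟨ length-combinations k Z ⟩
        length Z C k              ≡⟨ cong (_C k) |Z| ⟩
        m C k                     ≤⟨ m+n≤o⇒m≤o∸n (m C k) size≤ ⟩
        length R ∸ m              ≡⟨ trans (length-take (length R ∸ m) R) (m≤n⇒m⊓n≡m (m∸n≤m (length R) m)) ⟨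
        length W                  ∎
        where open ≤-Reasoning

      advance : ∀ {h′ Y} → JoinAll k M h W (combinations k Z) Z h′ → Y ⊆ Z → k + size s ≤ length Y →
                ∀ c → Homogeneous (suc d) (CommonNeighbour G h′ W c) Y → Forces Goal h′
      advance {h′} {Y} J Y⊆ |Y| c common = continue (B c) refl
        where
        Y⊆R : ∀ {y} → y ∈ Y → y ∈ R
        Y⊆R = Z⊆R ∘ lookup Y⊆

        B′ : Colour → List (Fin (n G))
        B′ = Vector.updateAt B c (drop 1)

        state : State B′ Y h′
        state .unique  = updateAt-elim (λ _ → Unique) B c (AllPairs.drop⁺ 1 (st .unique c)) (st .unique)
        state .orderOK = updateAt-elim (λ _ → OrderOK Fin._≟_ (suc d) (edges G)) B c
          (OrderOK-tail (B c) (st .orderOK c)) (st .orderOK)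
          where
          OrderOK-tail : ∀ L → OrderOK Fin._≟_ (suc d) (edges G) L →
                         OrderOK Fin._≟_ (suc d) (edges G) (drop 1 L)
          OrderOK-tail []      _        = tt
          OrderOK-tail (_ ∷ _) (_ , ok) = ok
        state .rich = updateAt-elim (λ c L → Rich G L c h′ Y) B c
          (Rich-tail G W Y (B c) W⊆R Y⊆R
            (λ w∈ y∈ → AllPairs-++⁻ W (subst (AllPairs _<_) (sym W++Z≡R) (st .sorted)) w∈ (lookup Y⊆ y∈))
            -- This is `suc d ≤ k ≤ length Y`, the room needed for padding.
            (≤-trans (s≤s (m≤m+n d (q * d))) (≤-trans (m≤m+n k (size s)) |Y|))
            common (st .unique c) (st .orderOK c) (Rich-mono G (JoinAll.grow J) id (st .rich c)))
          (λ j → Rich-mono G (JoinAll.grow J) Y⊆R (st .rich j))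
        state .sorted  = AllPairs-resp-⊆ Y⊆ (AllPairs.drop⁺ (length R ∸ m) (st .sorted))
        state .bounded = st .bounded ∘ Y⊆R
        state .sparse  = JoinAll.sparse J
        state .sources = λ e∈ → JoinAll.sources J e∈ ∘ lookup Y⊆

        continue : ∀ L → B c ≡ L → Forces Goal h′
        -- The part of colour `c` was exhausted before this round, so a copy in colour `c` is
        -- already present.
        continue []      Bc≡ = done
          (Rich[]⇒MonoCopy G (Rich-mono G (JoinAll.grow J) Y⊆R
             (subst (λ L → Rich G L c h R) Bc≡ (st .rich c))) , JoinAll.sparse J)
        continue (u ∷ L) Bc≡ = forces s state
          (<-≤-trans
            (sum-mono-< (updateAt-elim (λ j L′ → length L′ ≤ length (B j)) B c (<⇒≤ shorter) (λ _ → ≤-refl)) c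
              (subst (λ L′ → length L′ < length (B c)) (sym (updateAt-updates c B)) shorter))
            (≤-pred sum<))
          (≤-trans (m≤n+m (size s) k) |Y|)
          where
          shorter : length (drop 1 (B c)) < length (B c)
          shorter = subst (λ L′ → length (drop 1 L′) < length L′) (sym Bc≡) (n<1+n (length L))

      next : ∀ {h′} → JoinAll k M h W (combinations k Z) Z h′ → Forces Goal h′
      next {h′} J =
        let Y , Y⊆ , |Y| , c , common = homogeneous W Z (size s) (≤-reflexive (sym |Z|))
              (λ {K} K⊆ |K| → JoinAll.joined J
                (subst (λ j → K ∈ combinations j Z) |K| (∈-combinations⁺ K⊆)))
        in advance J Y⊆ |Y| c common

  initial : ∀ {M L} → Unique L → (∀ v → v ∈ L) → OrderOK Fin._≟_ (suc d) (edges G) L →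
            State M (λ _ → L) (upTo M) []
  initial {M} uniq all ok = record
    { unique  = λ _ → uniq
    ; orderOK = λ _ → ok
    ; rich    = λ _ → Rich-initial G all
    ; sorted  = upTo-increasing M
    ; bounded = ∈-upTo⁻
    ; sparse  = record { increasing = λ () ; out = λ _ → [] , z≤n , λ () }
    ; sources = λ ()
    }

-- Identifies the degeneracy bound of the theorem with `k`.
[1+q]*[1+d]∸q : ∀ q d → suc q * suc d ∸ q ≡ suc (suc q * d)
[1+q]*[1+d]∸q q d = begin
  suc q * suc d ∸ q         ≡⟨ cong (_∸ q) (*-suc (suc q) d) ⟩
  suc (q + suc q * d) ∸ q   ≡⟨ cong (_∸ q) (+-suc q (suc q * d)) ⟨
  q + suc (suc q * d) ∸ q   ≡⟨ m+n∸m≡n q (suc (suc q * d)) ⟩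
  suc (suc q * d)           ∎
  where open ≡-Reasoning

theorem4p1 : (q d : ℕ) → 1 ≤ q → 1 ≤ d → (G : Graph) → DegenerateGraph d G →
    Σ (Builder q) λ B → (P : Painter q) → Σ ℕ λ T →
    MonoCopy G (play B P T)
    × (∀ t → t < T → Legal (play B P t) (B (play B P t)))
    × (∀ t → t ≤ T → Degenerate _≟_ (q * d ∸ (q ∸ 1)) (exposed (play B P t)))
theorem4p1 (suc q) (suc d) _ _ G degenerate
  with degeneracyOrder G degenerate
... | L , uniq , all , ok = follow F , λ P →
  let T , (copy , sparse) , legal = follow-wins (follow F) P F 0 refl (λ _ → refl)
  in T , copy , (λ t → legal t z≤n) , λ t t≤T →
     subst (λ k → Degenerate _≟_ k (exposed (play (follow F) P t))) (sym ([1+q]*[1+d]∸q q d))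
       -- Earlier positions expose subgraphs of the final one and inherit its sparseness.
       (Sparse⇒Degenerate (Sparse-antitone (exposed-play-mono (follow F) P T t≤T) sparse))
  where
  open Strategy q d G
  s : ℕ
  -- One round per vertex and colour, and a last one in which an empty part is hit.
  s = suc (sum {suc q} (λ _ → length L))
  F : Forces (Goal (size s)) []
  F = forces (size s) s (initial uniq all ok) ≤-refl (≤-reflexive (sym (length-upTo (size s))))
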